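{- If $G$ is a connected graph of order $n$ with $2\leq n\leq 6$, then $\operatorname{th}_d(G)=\operatorname{th}_c(G)-1$.
   Context: Cops and Robbers on a finite simple graph with $n$ vertices: in round $0$ each of $k$ cops and then the robber choose a vertex; in each later round each cop stays or moves along an edge, then the robber does the same; capture occurs when a cop occupies the robber's vertex. $\operatorname{capt}_k(G)$ is the minimum number of rounds for $k$ cops to capture a robber who evades as long as possible ($\infty$ if $k$ is less than the cop number). A vertex is damaged if the robber occupies it in a round in which capture does not occur; $\operatorname{dmg}_k(G)$ is the minimum number of damaged vertices over games with $k$ cops when the robber maximizes damage. $\operatorname{th}_c(G)=\min_{1\le k\le n}\{k+\operatorname{capt}_k(G)\}$, $\operatorname{th}_d(G)=\min_{1\le k\le n}\{k+\operatorname{dmg}_k(G)\}$. -}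

module Defs where

open import Data.Nat using (ℕ; zero; suc; _+_; _≤_)
open import Data.Fin using (Fin)
open import Data.Fin.Subset using (Subset; ⊥; _∪_; ⁅_⁆; ∣_∣)
open import Data.Product using (Σ; ∃; ∃-syntax; _×_; _,_)
open import Data.Sum using (_⊎_)
open import Relation.Binary.PropositionalEquality using (_≡_)
open import Relation.Nullary using (¬_; Dec)

record SimpleGraph (n : ℕ) : Set₁ where
  field
    Adj    : Fin n → Fin n → Set
    adj?   : ∀ u v → Dec (Adj u v)
    sym    : ∀ {u v} → Adj u v → Adj v u
    irrefl : ∀ {u} → ¬ Adj u u

open SimpleGraph public

data Reachable {n : ℕ} (G : SimpleGraph n) : Fin n → Fin n → Set where
  here : ∀ {u} → Reachable G u u
  step : ∀ {u v w} → Adj G u v → Reachable G v w → Reachable G u w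

Connected : ∀ {n} → SimpleGraph n → Set
Connected G = ∀ u v → Reachable G u v

-- Moves.  A configuration of k cops is a function Fin k → Fin n
-- (several cops may share a vertex).

Cops : ℕ → ℕ → Set
Cops n k = Fin k → Fin n

Step : ∀ {n} → SimpleGraph n → Fin n → Fin n → Set
Step G u v = (v ≡ u) ⊎ Adj G u v

CopStep : ∀ {n k} → SimpleGraph n → Cops n k → Cops n k → Set
CopStep G c c' = ∀ i → Step G (c i) (c' i)

_∈C_ : ∀ {n k} → Fin n → Cops n k → Set
r ∈C c = ∃[ i ] c i ≡ r

-- CaptureWithin G t c r : it is the cops' turn (some round ≥ 1 is about
-- to start), cops at c, robber at r (not captured), and the cops can
-- force capture within at most t further rounds.

CaptureWithin : ∀ {n k} → SimpleGraph n → ℕ → Cops n k → Fin n → Set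
CaptureWithin G zero    c r = Data.Empty.⊥
  where import Data.Empty
CaptureWithin G (suc t) c r =
  Σ _ λ c' → CopStep G c c' ×
    ( (r ∈C c')
    ⊎ (∀ r' → Step G r r' → (r' ∈C c') ⊎ CaptureWithin G t c' r'))

-- k cops can capture the robber by the end of round t
-- (round 0 = initial placement)
CanCapture : ∀ {n} → SimpleGraph n → (k t : ℕ) → Set
CanCapture {n} G k t =
  Σ (Cops n k) λ c₀ → ∀ r₀ → (r₀ ∈C c₀) ⊎ CaptureWithin G t c₀ r₀

-- capt_k(G) = t  (capt_k(G) = ∞ means: no t satisfies IsCapt)
IsCapt : ∀ {n} → SimpleGraph n → (k t : ℕ) → Set
IsCapt G k t = CanCapture G k t × (∀ s → CanCapture G k s → t ≤ s)

-- Convention: the vertex the robber occupies at the end of a round is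
-- damaged unless the robber is captured in the following round (by the
-- cops' move).  A game state at the cops' turn is (c , r , D): cops at c,
-- robber at r (not captured), D = set of vertices already damaged.
--
-- "The cops can keep the number of damaged vertices at most d forever"
-- is a safety condition on a possibly infinite play, i.e. a greatest
-- fixed point.  Coinductive records need --guardedness (not allowed
-- here), so we use the standard coinduction principle: a state is
-- winning iff it lies in some set W of states that is closed under the
-- one-round step (a "post-fixed point").  W is exactly the set of states
-- from which the cops have a strategy keeping the damage ≤ d.

DamageStep : ∀ {n k} → SimpleGraph n → ℕ →
             (Cops n k → Fin n → Subset n → Set) →
             Cops n k → Fin n → Subset n → Set
DamageStep {n} {k} G d W c r D =
  Σ (Cops n k) λ c' → CopStep G c c' ×
    ( (r ∈C c')
    ⊎ ( (∣ D ∪ ⁅ r ⁆ ∣ ≤ d)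
      × (∀ r' → Step G r r' → (r' ∈C c') ⊎ W c' r' (D ∪ ⁅ r ⁆))))

DamageInvariant : ∀ {n k} → SimpleGraph n → ℕ →
                  (Cops n k → Fin n → Subset n → Set) → Set
DamageInvariant G d W = ∀ c r D → W c r D → DamageStep G d W c r D

CanLimitDamage : ∀ {n} → SimpleGraph n → (k d : ℕ) → Set₁
CanLimitDamage {n} G k d =
  Σ (Cops n k → Fin n → Subset n → Set) λ W → DamageInvariant G d W ×
  Σ (Cops n k) λ c₀ → ∀ r₀ → (r₀ ∈C c₀) ⊎ W c₀ r₀ ⊥

IsDmg : ∀ {n} → SimpleGraph n → (k d : ℕ) → Set₁
IsDmg G k d = CanLimitDamage G k d × (∀ e → CanLimitDamage G k e → d ≤ e)

-- th_c(G) = m : m = min_{1≤k≤n} (k + capt_k(G)), terms with capt_k = ∞ ignored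
IsThc : ∀ {n} → SimpleGraph n → ℕ → Set
IsThc {n} G m =
  (∃[ k ] ∃[ t ] (1 ≤ k × k ≤ n × IsCapt G k t × k + t ≡ m))
  × (∀ k t → 1 ≤ k → k ≤ n → IsCapt G k t → m ≤ k + t)

IsThd : ∀ {n} → SimpleGraph n → ℕ → Set₁
IsThd {n} G m =
  (∃[ k ] ∃[ d ] (1 ≤ k × k ≤ n × IsDmg G k d × k + d ≡ m))
  × (∀ k d → 1 ≤ k → k ≤ n → IsDmg G k d → m ≤ k + d)

-- With a dominating vertex, one cop prevents all damage and captures in one
-- round, so th_d = 1 and th_c = 2.  Otherwise one cop can neither capture
-- within a round nor prevent all damage, and capture in round 0 needs a cop
-- on every vertex, i.e. k ≥ n ≥ 3; hence th_d ≥ 2 and th_c ≥ 3.  These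
-- bounds are attained by two dominating vertices (no damage, capture in one
-- round) or by a single cop starting at a capture post v: it captures a
-- robber next to v at once and otherwise steps to a neighbour c of v whose
-- closed neighbourhood contains the robber's, so at most one vertex is
-- damaged and capture takes two rounds.  That every connected graph on at
-- most six vertices has a dominating pair or a capture post is checked by
-- enumerating all graphs.
module Submission where

open import Defs
open import Data.Nat using (ℕ; zero; suc; _+_; _≤_; z≤n; s≤s)
open import Data.Nat.Properties using (≤-refl; ≤-trans; ≤-reflexive; <⇒≤; m≤m+n; +-mono-≤; +-cancelˡ-≤)
open import Data.Bool using (Bool; true; false; T; not; _∧_; _∨_)
open import Data.Bool.Properties using (T-≡; T-∧; T-∨)
open import Data.Empty using (⊥-elim)
open import Data.Fin using (Fin; zero; suc)
open import Data.Fin.Properties using (_≟_; any?; all?; injective⇒≤)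
open import Data.Fin.Subset using (Subset; _∪_; ⁅_⁆; ∣_∣) renaming (⊥ to ∅)
open import Data.Fin.Subset.Properties using (∪-identityˡ; ∣⁅x⁆∣≡1)
open import Data.Product using (Σ; ∃; ∃-syntax; _×_; _,_; proj₁; proj₂)
import Data.Product as Product
open import Data.Sum using (_⊎_; inj₁; inj₂; [_,_])
import Data.Sum as Sum
open import Data.Vec using (Vec; []; _∷_; lookup; tabulate)
open import Data.Vec.Properties using (lookup∘tabulate)
open import Function using (id; const)
open import Function.Bundles using (_⇔_; mk⇔; Equivalence)
open import Relation.Nullary using (Dec; ¬_; yes; no; contradiction)
open import Relation.Nullary.Decidable using (_⊎-dec_; isYes; toWitness; fromWitness)
open import Relation.Binary.PropositionalEquality using (_≡_; refl; trans; cong; subst) renaming (sym to ≡-sym)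

open Equivalence using (to; from)

private
  variable
    n k t d : ℕ
    u v w : Fin n
    c : Cops n k

step? : (G : SimpleGraph n) → ∀ u v → Dec (Step G u v)
step? G u v = (v ≟ u) ⊎-dec adj? G u v

DominatingVertex : SimpleGraph n → Fin n → Set
DominatingVertex G v = ∀ r → Step G v r

dominatingVertex? : (G : SimpleGraph n) → Dec (∃ (DominatingVertex G))
dominatingVertex? G = any? λ v → all? λ r → step? G v r

DominatingPair : SimpleGraph n → Set
DominatingPair {n} G = ∃[ a ] ∃[ b ] (∀ r → Step G a r ⊎ Step G b r)

CatchesInTwo : SimpleGraph n → Fin n → Fin n → Set
CatchesInTwo {n} G v r = Step G v r ⊎ ∃[ c ] (Step G v c × (∀ r′ → Step G r r′ → Step G c r′))

CapturePost : SimpleGraph n → Fin n → Set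
CapturePost G v = ∀ r → CatchesInTwo G v r

reachable-closed : {G : SimpleGraph n} (P : Fin n → Set) → (∀ {x y} → P x → Adj G x y → P y) →
                   Reachable G u w → P u → P w
reachable-closed P closed here       Pu = Pu
reachable-closed P closed (step a p) Pu = reachable-closed P closed p (closed Pu a)

3≤order : {G : SimpleGraph n} → Connected G → 1 ≤ n → ¬ ∃ (DominatingVertex G) → 3 ≤ n
3≤order {n = 1} _ _ ¬dv = ⊥-elim (¬dv (zero , λ { zero → inj₁ refl }))
3≤order {n = 2} {G} conn _ ¬dv =
  ⊥-elim (¬dv (zero , λ { zero → inj₁ refl ; (suc zero) → first-edge (conn zero (suc zero)) }))
  where
  first-edge : Reachable G zero (suc zero) → Step G zero (suc zero)
  first-edge (step {v = zero} a _) = ⊥-elim (irrefl G a)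
  first-edge (step {v = suc zero} a _) = inj₂ a
3≤order {n = suc (suc (suc _))} _ _ _ = s≤s (s≤s (s≤s z≤n))

T-not⇒¬T : ∀ {x} → T (not x) → ¬ T x
T-not⇒¬T {false} _ ()

T-not∨⇒ : ∀ {x y} → T (not x ∨ y) → T x → T y
T-not∨⇒ {true} t _ = t

allᶠ : (Fin n → Bool) → Bool
allᶠ {zero}  p = true
allᶠ {suc n} p = p zero ∧ allᶠ (λ i → p (suc i))

anyᶠ : (Fin n → Bool) → Bool
anyᶠ {zero}  p = false
anyᶠ {suc n} p = p zero ∨ anyᶠ (λ i → p (suc i))

allᶠ-sound : (p : Fin n → Bool) → T (allᶠ p) → ∀ i → T (p i)
allᶠ-sound p holds zero    = proj₁ (to T-∧ holds)
allᶠ-sound p holds (suc i) = allᶠ-sound _ (proj₂ (to T-∧ holds)) i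

anyᶠ-sound : (p : Fin n → Bool) → T (anyᶠ p) → ∃ λ i → T (p i)
anyᶠ-sound {suc n} p some =
  [ zero ,_ , (λ later → Product.map suc id (anyᶠ-sound _ later)) ] (to (T-∨ {p zero}) some)

allVectorsᵇ : (Vec Bool n → Bool) → Bool
allVectorsᵇ {zero}  p = p []
allVectorsᵇ {suc n} p = allVectorsᵇ (λ s → p (true ∷ s)) ∧ allVectorsᵇ (λ s → p (false ∷ s))

anyVectorsᵇ : (Vec Bool n → Bool) → Bool
anyVectorsᵇ {zero}  p = p []
anyVectorsᵇ {suc n} p = anyVectorsᵇ (λ s → p (true ∷ s)) ∨ anyVectorsᵇ (λ s → p (false ∷ s))

allVectorsᵇ-sound : (p : Vec Bool n → Bool) → T (allVectorsᵇ p) → ∀ s → T (p s)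
allVectorsᵇ-sound p holds []          = holds
allVectorsᵇ-sound p holds (true  ∷ s) = allVectorsᵇ-sound _ (proj₁ (to T-∧ holds)) s
allVectorsᵇ-sound p holds (false ∷ s) = allVectorsᵇ-sound _ (proj₂ (to T-∧ holds)) s

anyVectorsᵇ-sound : (p : Vec Bool n → Bool) → T (anyVectorsᵇ p) → ∃ λ s → T (p s)
anyVectorsᵇ-sound {zero}  p some = [] , some
anyVectorsᵇ-sound {suc n} p some = [ extendWith true , extendWith false ] (to T-∨ some)
  where
  extendWith : ∀ b → T (anyVectorsᵇ λ s → p (b ∷ s)) → ∃ λ s → T (p s)
  extendWith b some′ = Product.map (b ∷_) id (anyVectorsᵇ-sound _ some′)

Adjacency : ℕ → Set
Adjacency n = Fin n → Fin n → Bool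

Represents : Adjacency n → SimpleGraph n → Set
Represents A G = ∀ u v → T (A u v) ⇔ Adj G u v

module _ (A : Adjacency n) where

  stepᵇ : Fin n → Fin n → Bool
  stepᵇ u v = isYes (v ≟ u) ∨ A u v

  dominatingPairᵇ : Bool
  dominatingPairᵇ = anyᶠ λ a → anyᶠ λ b → allᶠ λ r → stepᵇ a r ∨ stepᵇ b r

  capturePostᵇ : Bool
  capturePostᵇ = anyᶠ λ v → allᶠ λ r → stepᵇ v r ∨
    anyᶠ λ c → stepᵇ v c ∧ allᶠ λ r′ → not (stepᵇ r r′) ∨ stepᵇ c r′

  separatedᵇ : Bool
  separatedᵇ = anyVectorsᵇ λ S → anyᶠ (lookup S) ∧ anyᶠ (λ w → not (lookup S w)) ∧
    allᶠ λ x → allᶠ λ y → not (lookup S x ∧ A x y) ∨ lookup S y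

  classifyᵇ : Bool
  classifyᵇ = dominatingPairᵇ ∨ capturePostᵇ ∨ separatedᵇ

module _ {A : Adjacency n} {G : SimpleGraph n} (A≈G : Represents A G) where

  stepᵇ-sound : ∀ u v → T (stepᵇ A u v) → Step G u v
  stepᵇ-sound u v t = Sum.map (toWitness {a? = v ≟ u}) (to (A≈G u v)) (to T-∨ t)

  stepᵇ-complete : ∀ u v → Step G u v → T (stepᵇ A u v)
  stepᵇ-complete u v s = from T-∨ (Sum.map (fromWitness {a? = v ≟ u}) (from (A≈G u v)) s)

  dominatingPairᵇ-sound : T (dominatingPairᵇ A) → DominatingPair G
  dominatingPairᵇ-sound t
    with a , ta ← anyᶠ-sound _ t
    with b , tb ← anyᶠ-sound _ ta =
    a , b , λ r → Sum.map (stepᵇ-sound a r) (stepᵇ-sound b r) (to T-∨ (allᶠ-sound _ tb r))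

  capturePostᵇ-sound : T (capturePostᵇ A) → ∃ (CapturePost G)
  capturePostᵇ-sound t with v , tv ← anyᶠ-sound _ t =
    v , λ r → post r (to T-∨ (allᶠ-sound _ tv r))
    where
    post : ∀ r →
           T (stepᵇ A v r) ⊎ T (anyᶠ λ c → stepᵇ A v c ∧ allᶠ λ r′ → not (stepᵇ A r r′) ∨ stepᵇ A c r′) →
           CatchesInTwo G v r
    post r (inj₁ s) = inj₁ (stepᵇ-sound v r s)
    post r (inj₂ some) with c , tc ← anyᶠ-sound _ some with s , cornered ← to T-∧ tc =
      inj₂ (c , stepᵇ-sound v c s , λ r′ s′ →
        stepᵇ-sound c r′ (T-not∨⇒ (allᶠ-sound _ cornered r′) (stepᵇ-complete r r′ s′)))

  separatedᵇ-sound : T (separatedᵇ A) → ¬ Connected G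
  separatedᵇ-sound t conn
    with S , tS ← anyVectorsᵇ-sound _ t
    with inside , rest ← to T-∧ tS
    with outside , closed ← to T-∧ rest
    with u , tu ← anyᶠ-sound _ inside
    with w , tw ← anyᶠ-sound _ outside =
    T-not⇒¬T tw (reachable-closed (λ x → T (lookup S x)) edge-closed (conn u w) tu)
    where
    edge-closed : ∀ {x y} → T (lookup S x) → Adj G x y → T (lookup S y)
    edge-closed {x} {y} tx a =
      T-not∨⇒ (allᶠ-sound _ (allᶠ-sound _ closed x) y) (from T-∧ (tx , from (A≈G x y) a))

  classifyᵇ-sound : Connected G → T (classifyᵇ A) → DominatingPair G ⊎ ∃ (CapturePost G)
  classifyᵇ-sound conn t with to T-∨ t
  ... | inj₁ pair = inj₁ (dominatingPairᵇ-sound pair)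
  ... | inj₂ t′ with to T-∨ t′
  ...   | inj₁ post = inj₂ (capturePostᵇ-sound post)
  ...   | inj₂ sep  = contradiction conn (separatedᵇ-sound sep)

removeZero : SimpleGraph (suc n) → SimpleGraph n
removeZero G = record
  { Adj    = λ u v → Adj G (suc u) (suc v)
  ; adj?   = λ u v → adj? G (suc u) (suc v)
  ; sym    = sym G
  ; irrefl = irrefl G
  }

extendᵃ : Adjacency n → Vec Bool n → Adjacency (suc n)
extendᵃ A s zero    zero    = false
extendᵃ A s zero    (suc j) = lookup s j
extendᵃ A s (suc i) zero    = lookup s i
extendᵃ A s (suc i) (suc j) = A i j

allAdjacenciesᵇ : ∀ n → (Adjacency n → Bool) → Bool
allAdjacenciesᵇ zero    p = p λ ()
allAdjacenciesᵇ (suc n) p = allAdjacenciesᵇ n λ A → allVectorsᵇ λ s → p (extendᵃ A s)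

neighboursOfZero : SimpleGraph (suc n) → Vec Bool n
neighboursOfZero G = tabulate λ j → isYes (adj? G zero (suc j))

T-neighboursOfZero : (G : SimpleGraph (suc n)) (j : Fin n) →
                     T (lookup (neighboursOfZero G) j) ⇔ Adj G zero (suc j)
T-neighboursOfZero G j =
  subst (λ b → T b ⇔ Adj G zero (suc j)) (≡-sym (lookup∘tabulate _ j)) (mk⇔ toWitness fromWitness)

extendᵃ-represents : {A : Adjacency n} {G : SimpleGraph (suc n)} → Represents A (removeZero G) →
                     Represents (extendᵃ A (neighboursOfZero G)) G
extendᵃ-represents {G = G} A≈G′ zero    zero    = mk⇔ (λ ()) (irrefl G)
extendᵃ-represents {G = G} A≈G′ zero    (suc j) = T-neighboursOfZero G j
extendᵃ-represents {G = G} A≈G′ (suc i) zero    =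
  mk⇔ (λ x → sym G (to (T-neighboursOfZero G i) x)) (λ a → from (T-neighboursOfZero G i) (sym G a))
extendᵃ-represents A≈G′ (suc i) (suc j) = A≈G′ i j

allAdjacenciesᵇ-represents : (p : Adjacency n → Bool) → T (allAdjacenciesᵇ n p) →
                             (G : SimpleGraph n) → ∃[ A ] Represents A G × T (p A)
allAdjacenciesᵇ-represents {zero}  p holds G = (λ ()) , (λ ()) , holds
allAdjacenciesᵇ-represents {suc n} p holds G
  with A , A≈G′ , allExtensions ←
       allAdjacenciesᵇ-represents (λ A → allVectorsᵇ λ s → p (extendᵃ A s)) holds (removeZero G) =
  extendᵃ A (neighboursOfZero G) , extendᵃ-represents {G = G} A≈G′ ,
  allVectorsᵇ-sound (λ s → p (extendᵃ A s)) allExtensions (neighboursOfZero G)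

-- Stated with ≡ rather than T: checking refl evaluates the Boolean far faster than checking tt.
adjacencies-classified : 1 ≤ n → n ≤ 6 → allAdjacenciesᵇ n classifyᵇ ≡ true
adjacencies-classified {1} _ _ = refl
adjacencies-classified {2} _ _ = refl
adjacencies-classified {3} _ _ = refl
adjacencies-classified {4} _ _ = refl
adjacencies-classified {5} _ _ = refl
adjacencies-classified {6} _ _ = refl
adjacencies-classified {suc (suc (suc (suc (suc (suc (suc _))))))} _
  (s≤s (s≤s (s≤s (s≤s (s≤s (s≤s ()))))))

dominatingPair⊎capturePost : {G : SimpleGraph n} → 1 ≤ n → n ≤ 6 → Connected G →
                             DominatingPair G ⊎ ∃ (CapturePost G)
dominatingPair⊎capturePost {G = G} 1≤n n≤6 conn
  with A , A≈G , classified ←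
       allAdjacenciesᵇ-represents classifyᵇ (from T-≡ (adjacencies-classified 1≤n n≤6)) G =
  classifyᵇ-sound A≈G conn classified

Dominating : SimpleGraph n → Cops n k → Set
Dominating G c = ∀ r → ∃[ i ] Step G (c i) r

∣∅∪⁅x⁆∣≡1 : (x : Fin n) → ∣ ∅ ∪ ⁅ x ⁆ ∣ ≡ 1
∣∅∪⁅x⁆∣≡1 x = trans (cong ∣_∣ (∪-identityˡ ⁅ x ⁆)) (∣⁅x⁆∣≡1 x)

module _ {n : ℕ} (G : SimpleGraph n) where

  dominatingVertex⇒dominating : DominatingVertex G v → Dominating {k = 1} G (const v)
  dominatingVertex⇒dominating dom r = zero , dom r

  dominating⇒dominatingVertex : Σ (Cops n 1) (Dominating G) → ∃ (DominatingVertex G)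
  dominating⇒dominatingVertex (c , dom) = c zero , λ r → vertex (dom r)
    where
    vertex : ∀ {r} → ∃[ i ] Step G (c i) r → Step G (c zero) r
    vertex (zero , s) = s

  copPair : Fin n → Fin n → Cops n 2
  copPair a b zero    = a
  copPair a b (suc _) = b

  dominatingPair⇒dominating : DominatingPair G → Σ (Cops n 2) (Dominating G)
  dominatingPair⇒dominating (a , b , dom) = copPair a b , λ r → [ (zero ,_) , (suc zero ,_) ] (dom r)

  chase : Cops n k → Fin n → Cops n k
  chase c r i with step? G (c i) r
  ... | yes _ = r
  ... | no  _ = c i

  chase-step : (c : Cops n k) (r : Fin n) → CopStep G c (chase c r)
  chase-step c r i with step? G (c i) r
  ... | yes s = s
  ... | no  _ = inj₁ refl

  chase-reaches : (c : Cops n k) {r : Fin n} (i : Fin k) →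
                  Step G (c i) r → chase c r i ≡ r
  chase-reaches c {r} i s with step? G (c i) r
  ... | yes _ = refl
  ... | no ¬s = contradiction s ¬s

  chase-captures : (c : Cops n k) {r : Fin n} →
                   ∃[ i ] Step G (c i) r → r ∈C chase c r
  chase-captures c (i , s) = i , chase-reaches c i s

  dominating⇒canCapture₁ : (c : Cops n k) → Dominating G c → CanCapture G k 1
  dominating⇒canCapture₁ c dom =
    c , λ r → inj₂ (chase c r , chase-step c r , inj₁ (chase-captures c (dom r)))

  dominating⇒canLimitDamage₀ : (c : Cops n k) → Dominating G c → CanLimitDamage G k 0
  dominating⇒canLimitDamage₀ c dom =
    (λ c′ _ _ → Dominating G c′) ,
    (λ c′ r _ dom′ → chase c′ r , chase-step c′ r , inj₁ (chase-captures c′ (dom′ r))) ,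
    c , λ _ → inj₂ dom

  ∈C⇒step : {r : Fin n} → r ∈C c → ∃[ i ] Step G (c i) r
  ∈C⇒step (i , refl) = i , inj₁ refl

  copStep-∈C : {c c′ : Cops n k} {r : Fin n} →
               CopStep G c c′ → r ∈C c′ → ∃[ i ] Step G (c i) r
  copStep-∈C moves (i , refl) = i , moves i

  canCapture₀⇒n≤k : CanCapture G k 0 → n ≤ k
  canCapture₀⇒n≤k (c , strategy) = injective⇒≤ {f = λ r → proj₁ (occupied r)} λ {x} {y} eq →
    trans (≡-sym (proj₂ (occupied x))) (trans (cong c eq) (proj₂ (occupied y)))
    where
    occupied : ∀ r → r ∈C c
    occupied r with strategy r
    ... | inj₁ occ = occ

  canCapture₁⇒dominating : CanCapture G k 1 → Σ (Cops n k) (Dominating G)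
  canCapture₁⇒dominating (c , strategy) = c , λ r → catcher (strategy r)
    where
    catcher : ∀ {r} → r ∈C c ⊎ CaptureWithin G 1 c r → ∃[ i ] Step G (c i) r
    catcher (inj₁ occ) = ∈C⇒step occ
    catcher (inj₂ (c′ , moves , inj₁ caught)) = copStep-∈C moves caught
    catcher {r} (inj₂ (c′ , moves , inj₂ escapes)) with escapes r (inj₁ refl)
    ... | inj₁ caught = copStep-∈C moves caught

  canLimitDamage₀⇒dominating : CanLimitDamage G k 0 → Σ (Cops n k) (Dominating G)
  canLimitDamage₀⇒dominating (W , invariant , c , strategy) = c , λ r → catcher (strategy r)
    where
    catcher : ∀ {r} → r ∈C c ⊎ W c r ∅ → ∃[ i ] Step G (c i) r
    catcher (inj₁ occ) = ∈C⇒step occ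
    catcher {r} (inj₂ w) with invariant c r ∅ w
    ... | c′ , moves , inj₁ caught = copStep-∈C moves caught
    ... | c′ , moves , inj₂ (damage≤0 , _) =
      contradiction (subst (_≤ 0) (∣∅∪⁅x⁆∣≡1 r) damage≤0) λ ()

  catchesInTwo⇒captureWithin₂ : {r : Fin n} → CatchesInTwo G v r → CaptureWithin {k = 1} G 2 (const v) r
  catchesInTwo⇒captureWithin₂ {r = r} (inj₁ v→r) = const r , const v→r , inj₁ (zero , refl)
  catchesInTwo⇒captureWithin₂ (inj₂ (c , v→c , cornered)) = const c , const v→c , inj₂ λ r′ r→r′ →
    inj₂ (const r′ , const (cornered r′ r→r′) , inj₁ (zero , refl))

  capturePost⇒canCapture₂ : CapturePost G v → CanCapture G 1 2
  capturePost⇒canCapture₂ {v = v} post = const v , λ r → inj₂ (catchesInTwo⇒captureWithin₂ (post r))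

  capturePost⇒canLimitDamage₁ : CapturePost G v → CanLimitDamage G 1 1
  capturePost⇒canLimitDamage₁ {v = v} post =
    W , invariant , const v , λ _ → inj₂ (inj₁ (refl , refl))
    where
    W : Cops _ 1 → Fin _ → Subset _ → Set
    W c r D = (c ≡ const v × D ≡ ∅) ⊎ Step G (c zero) r
    invariant : DamageInvariant G 1 W
    invariant c r D (inj₂ c→r) = const r , (λ { zero → c→r }) , inj₁ (zero , refl)
    invariant .(const v) r .∅ (inj₁ (refl , refl)) with post r
    ... | inj₁ v→r = const r , const v→r , inj₁ (zero , refl)
    ... | inj₂ (c , v→c , cornered) =
      const c , const v→c , inj₂ (≤-reflexive (∣∅∪⁅x⁆∣≡1 r) , λ r′ r→r′ → inj₂ (inj₂ (cornered r′ r→r′)))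

  isThc-intro : (k t : ℕ) → 1 ≤ k → k ≤ n → CanCapture G k t →
                (∀ {k′ t′} → 1 ≤ k′ → CanCapture G k′ t′ → k + t ≤ k′ + t′) →
                IsThc G (k + t)
  isThc-intro k t 1≤k k≤n capture optimal =
    (k , t , 1≤k , k≤n , (capture , λ s capture′ → +-cancelˡ-≤ k t s (optimal 1≤k capture′)) , refl) ,
    λ _ _ 1≤k′ _ (capture′ , _) → optimal 1≤k′ capture′

  isThd-intro : (k d : ℕ) → 1 ≤ k → k ≤ n → CanLimitDamage G k d →
                (∀ {k′ d′} → 1 ≤ k′ → CanLimitDamage G k′ d′ → k + d ≤ k′ + d′) →
                IsThd G (k + d)
  isThd-intro k d 1≤k k≤n limit optimal =
    (k , d , 1≤k , k≤n , (limit , λ e limit′ → +-cancelˡ-≤ k d e (optimal 1≤k limit′)) , refl) ,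
    λ _ _ 1≤k′ _ (limit′ , _) → optimal 1≤k′ limit′

  capture-lowerBound₂ : 2 ≤ n → 1 ≤ k → CanCapture G k t → 2 ≤ k + t
  capture-lowerBound₂ {k = k} {t = zero} 2≤n _ capture =
    ≤-trans 2≤n (≤-trans (canCapture₀⇒n≤k capture) (m≤m+n k 0))
  capture-lowerBound₂ {t = suc _} _ 1≤k _ = +-mono-≤ 1≤k (s≤s z≤n)

  capture-lowerBound₃ : Connected G → 1 ≤ n → ¬ ∃ (DominatingVertex G) →
                        1 ≤ k → CanCapture G k t → 3 ≤ k + t
  capture-lowerBound₃ {k = k} {t = zero} conn 1≤n ¬dv _ capture =
    ≤-trans (3≤order conn 1≤n ¬dv) (≤-trans (canCapture₀⇒n≤k capture) (m≤m+n k 0))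
  capture-lowerBound₃ {k = 1} {t = 1} _ _ ¬dv _ capture =
    ⊥-elim (¬dv (dominating⇒dominatingVertex (canCapture₁⇒dominating capture)))
  capture-lowerBound₃ {k = 1} {t = suc (suc _)} _ _ _ _ _ = s≤s (s≤s (s≤s z≤n))
  capture-lowerBound₃ {k = suc (suc _)} {t = suc _} _ _ _ _ _ = +-mono-≤ (s≤s (s≤s z≤n)) (s≤s z≤n)

  damage-lowerBound₂ : ¬ ∃ (DominatingVertex G) → 1 ≤ k → CanLimitDamage G k d → 2 ≤ k + d
  damage-lowerBound₂ {k = 1} {d = zero} ¬dv _ limit =
    ⊥-elim (¬dv (dominating⇒dominatingVertex (canLimitDamage₀⇒dominating limit)))
  damage-lowerBound₂ {k = suc (suc _)} {d = zero} _ _ _ = s≤s (s≤s z≤n)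
  damage-lowerBound₂ {d = suc _} _ 1≤k _ = +-mono-≤ 1≤k (s≤s z≤n)

  throttling-dominatingVertex : 2 ≤ n → DominatingVertex G v → IsThd G 1 × IsThc G 2
  throttling-dominatingVertex {v = v} 2≤n dv =
    isThd-intro 1 0 ≤-refl (<⇒≤ 2≤n) (dominating⇒canLimitDamage₀ (const v) dom)
      (λ {k} {d} 1≤k _ → ≤-trans 1≤k (m≤m+n k d)) ,
    isThc-intro 1 1 ≤-refl (<⇒≤ 2≤n) (dominating⇒canCapture₁ (const v) dom)
      (capture-lowerBound₂ 2≤n)
    where
    dom : Dominating G (const v)
    dom = dominatingVertex⇒dominating dv

  throttling-dominatingPair : Connected G → 2 ≤ n → ¬ ∃ (DominatingVertex G) →
                              DominatingPair G → IsThd G 2 × IsThc G 3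
  throttling-dominatingPair conn 2≤n ¬dv pair with dominatingPair⇒dominating pair
  ... | c , dom =
    isThd-intro 2 0 (s≤s z≤n) 2≤n (dominating⇒canLimitDamage₀ c dom)
      (damage-lowerBound₂ ¬dv) ,
    isThc-intro 2 1 (s≤s z≤n) 2≤n (dominating⇒canCapture₁ c dom)
      (capture-lowerBound₃ conn (<⇒≤ 2≤n) ¬dv)

  throttling-capturePost : Connected G → 2 ≤ n → ¬ ∃ (DominatingVertex G) →
                           CapturePost G v → IsThd G 2 × IsThc G 3
  throttling-capturePost conn 2≤n ¬dv post =
    isThd-intro 1 1 ≤-refl (<⇒≤ 2≤n) (capturePost⇒canLimitDamage₁ post)
      (damage-lowerBound₂ ¬dv) ,
    isThc-intro 1 2 ≤-refl (<⇒≤ 2≤n) (capturePost⇒canCapture₂ post)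
      (capture-lowerBound₃ conn (<⇒≤ 2≤n) ¬dv)

proposition2p19 : ∀ (n : ℕ) → 2 ≤ n → n ≤ 6 → (G : SimpleGraph n) → Connected G →
    ∃[ m ] (IsThd G m × IsThc G (Data.Nat.suc m))
proposition2p19 n 2≤n n≤6 G conn with dominatingVertex? G
... | yes (v , dv) = 1 , throttling-dominatingVertex G 2≤n dv
... | no ¬dv with dominatingPair⊎capturePost (<⇒≤ 2≤n) n≤6 conn
...   | inj₁ pair       = 2 , throttling-dominatingPair G conn 2≤n ¬dv pair
...   | inj₂ (v , post) = 2 , throttling-capturePost G conn 2≤n ¬dv post
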